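{- Let $f:\omega\to\omega$ be a computable, nondecreasing, unbounded function. If $A \subseteq \omega$ is a $\Delta^0_2$ set that has an asymptotic density, then there is an $f$-c.e. set $B$ that has an asymptotic density, with $\rho(B)=\rho(A)$.
   Context: For $X \subseteq \omega=\{0,1,2,\dots\}$ and an integer $m>0$, let $\rho_m(X) = |\{j \in X : j < m\}|/m$. The set $X$ has a (asymptotic) density if $\lim_m \rho_m(X)$ exists, and the density is then $\rho(X) = \lim_m \rho_m(X)$. Sets are identified with their characteristic functions. For a function $f:\omega\to\omega$, a set $A \subseteq \omega$ is $f$-c.e. if there is a computable function $g:\omega\times\omega\to\{0,1\}$ such that for all $x$: $g(x,0)=0$, $A(x)=\lim_s g(x,s)$, and $|\{s : g(x,s) \neq g(x,s+1)\}| \leq f(x)$. -}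

module Defs where

open import Axiom.ExcludedMiddle using (ExcludedMiddle)
open import Data.Bool.Base using (Bool; true; false; if_then_else_)
open import Data.Bool.Properties using (¬-not)
open import Data.Fin.Base using (Fin)
open import Data.Integer.Base using (+_)
open import Data.List.Base using (List; length)
open import Data.List.Membership.Propositional using (_∈_)
open import Data.Nat.Base using (ℕ; zero; suc; _+_; _≤_; _<_; NonZero)
open import Data.Product.Base using (∃; _×_; _,_)
open import Data.Rational.Base as ℚ using (ℚ; 0ℚ)
open import Data.Vec.Base using (Vec; []; _∷_; lookup)
open import Data.Vec.N-ary using (N-ary; _$ⁿ_)
open import Data.Vec.Relation.Binary.Pointwise.Inductive using (Pointwise)
open import Function.Base using (_∘_)
open import Function.Bundles using (_⇔_; mk⇔; Equivalence)
open import Level using (0ℓ)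
open import Relation.Binary.PropositionalEquality.Core
  using (_≡_; _≢_; refl; sym; trans)
open import Relation.Nullary.Decidable.Core using (yes; no)
open import Relation.Nullary.Negation.Core using (¬_; contradiction)

------------------------------------------------------------------------
-- Computable functions: Kleene's μ-recursive functions

data Rec : ℕ → Set where
  Z    : ∀ {n} → Rec n
  S    : Rec 1
  proj : ∀ {n} → Fin n → Rec n
  comp : ∀ {m n} → Rec m → Vec (Rec n) m → Rec n
  prec : ∀ {n} → Rec n → Rec (2 + n) → Rec (suc n)
  μ    : ∀ {n} → Rec (suc n) → Rec n

infix 4 _⟨_⟩⇓_

-- c ⟨ xs ⟩⇓ y : the partial function coded by c is defined at xs, with
-- value y.

data _⟨_⟩⇓_ : ∀ {n} → Rec n → Vec ℕ n → ℕ → Set where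
  ⇓Z     : ∀ {n} {xs : Vec ℕ n} → Z ⟨ xs ⟩⇓ 0
  ⇓S     : ∀ {x} → S ⟨ x ∷ [] ⟩⇓ suc x
  ⇓proj  : ∀ {n} {xs : Vec ℕ n} (i : Fin n) → proj i ⟨ xs ⟩⇓ lookup xs i
  ⇓comp  : ∀ {m n} {c : Rec m} {ds : Vec (Rec n) m} {xs ys z} →
           Pointwise (λ d y → d ⟨ xs ⟩⇓ y) ds ys → c ⟨ ys ⟩⇓ z →
           comp c ds ⟨ xs ⟩⇓ z
  ⇓prec0 : ∀ {n} {c : Rec n} {d : Rec (2 + n)} {xs z} →
           c ⟨ xs ⟩⇓ z → prec c d ⟨ 0 ∷ xs ⟩⇓ z
  ⇓precS : ∀ {n} {c : Rec n} {d : Rec (2 + n)} {k xs y z} →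
           prec c d ⟨ k ∷ xs ⟩⇓ y → d ⟨ k ∷ y ∷ xs ⟩⇓ z →
           prec c d ⟨ suc k ∷ xs ⟩⇓ z
  ⇓μ     : ∀ {n} {c : Rec (suc n)} {xs k} →
           (∀ i → i < k → ∃ λ v → c ⟨ i ∷ xs ⟩⇓ suc v) →
           c ⟨ k ∷ xs ⟩⇓ 0 → μ c ⟨ xs ⟩⇓ k

Computable : ∀ n → N-ary n ℕ ℕ → Set
Computable n f = ∃ λ (c : Rec n) → ∀ xs → c ⟨ xs ⟩⇓ (f $ⁿ xs)

------------------------------------------------------------------------
-- Sets of natural numbers, as characteristic functions

SubsetOfℕ : Set
SubsetOfℕ = ℕ → Bool

bit : Bool → ℕ
bit b = if b then 1 else 0

------------------------------------------------------------------------
-- The class Δ⁰₂ of the arithmetical hierarchy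

-- In Σ⁰₂ and Π⁰₂, the equivalence for A x ≡ false is the De Morgan dual
-- of the one for A x ≡ true.  Classically each follows from the other
-- (see EM⇒Σ⁰₂ and EM⇒Π⁰₂), but constructively membership and
-- non-membership both need to be given positively.

Σ⁰₂ : SubsetOfℕ → Set
Σ⁰₂ A = ∃ λ (R : ℕ → ℕ → ℕ → Bool) →
  Computable 3 (λ x y z → bit (R x y z)) ×
  (∀ x → (A x ≡ true  ⇔ ∃ λ y → ∀ z → R x y z ≡ true) ×
         (A x ≡ false ⇔ (∀ y → ∃ λ z → R x y z ≡ false)))

Π⁰₂ : SubsetOfℕ → Set
Π⁰₂ A = ∃ λ (R : ℕ → ℕ → ℕ → Bool) →
  Computable 3 (λ x y z → bit (R x y z)) ×
  (∀ x → (A x ≡ true  ⇔ (∀ y → ∃ λ z → R x y z ≡ true)) ×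
         (A x ≡ false ⇔ ∃ λ y → ∀ z → R x y z ≡ false))

Δ⁰₂ : SubsetOfℕ → Set
Δ⁰₂ A = Σ⁰₂ A × Π⁰₂ A

module _ (em : ExcludedMiddle 0ℓ) where

  private
    dne : {P : Set} → ¬ ¬ P → P
    dne {P} ¬¬p with em {P}
    ... | yes p = p
    ... | no ¬p = contradiction ¬p ¬¬p

    clash : {b : Bool} → b ≡ true → ¬ (b ≡ false)
    clash refl ()

    -- For Boolean b, an equivalence for one value of b dualises.
    flip⇔ : ∀ {b c d : Bool} {P Q : Set} → c ≢ d →
            (b ≢ d → b ≡ c) → (¬ P → Q) → (Q → ¬ P) →
            (b ≡ c ⇔ P) → (b ≡ d ⇔ Q)
    flip⇔ c≢d other f g e = mk⇔
      (λ b≡d → f λ p → c≢d (trans (sym (Equivalence.from e p)) b≡d))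
      (λ q → dne λ b≢d → g q (Equivalence.to e (other b≢d)))

  EM⇒Σ⁰₂ : (A : SubsetOfℕ) (R : ℕ → ℕ → ℕ → Bool) →
           Computable 3 (λ x y z → bit (R x y z)) →
           (∀ x → A x ≡ true ⇔ ∃ λ y → ∀ z → R x y z ≡ true) →
           Σ⁰₂ A
  EM⇒Σ⁰₂ A R cR e = R , cR , λ x → e x ,
    flip⇔ (λ ()) ¬-not
      (λ ¬p y → dne λ ¬q → ¬p (y , λ z → ¬-not λ r → ¬q (z , r)))
      (λ { q (y , p) → let (z , r) = q y in clash (p z) r })
      (e x)

  EM⇒Π⁰₂ : (A : SubsetOfℕ) (R : ℕ → ℕ → ℕ → Bool) →
           Computable 3 (λ x y z → bit (R x y z)) →
           (∀ x → A x ≡ true ⇔ (∀ y → ∃ λ z → R x y z ≡ true)) →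
           Π⁰₂ A
  EM⇒Π⁰₂ A R cR e = R , cR , λ x → e x ,
    flip⇔ (λ ()) ¬-not
      (λ ¬p → dne λ ¬q → ¬p λ y → dne λ ¬r →
        ¬q (y , λ z → ¬-not λ r → ¬r (z , r)))
      (λ { (y , p) q → let (z , r) = q y in clash r (p z) })
      (e x)

------------------------------------------------------------------------
-- f-c.e. sets

-- lim_s h s = b in the discrete space Bool.

Lim : (ℕ → Bool) → Bool → Set
Lim h b = ∃ λ s₀ → ∀ s → s₀ ≤ s → h s ≡ b

∣_∣≤_ : (ℕ → Set) → ℕ → Set
∣ P ∣≤ k = ∃ λ (l : List ℕ) → length l ≤ k × (∀ s → P s → s ∈ l)

record _-CE (f : ℕ → ℕ) (A : SubsetOfℕ) : Set where
  field
    g            : ℕ → ℕ → Bool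
    g-computable : Computable 2 (λ x s → bit (g x s))
    g-start      : ∀ x → g x 0 ≡ false
    g-limit      : ∀ x → Lim (g x) (A x)
    g-changes    : ∀ x → ∣ (λ s → g x s ≢ g x (suc s)) ∣≤ f x

------------------------------------------------------------------------
-- Real numbers, as regular Cauchy sequences of rationals

record ℝ : Set where
  field
    seq     : ℕ → ℚ
    regular : ∀ m n →
      ℚ.∣ seq m ℚ.- seq n ∣ ℚ.≤ (+ 1 ℚ./ suc m) ℚ.+ (+ 1 ℚ./ suc n)

-- The inequality ∣ q - r ∣ ≤ ε between real numbers, for rational q and
-- ε: regularity puts seq r n within 1/(n+1) of r.

∣_-_∣≤_ : ℚ → ℝ → ℚ → Set
∣ q - r ∣≤ ε = ∀ n → ℚ.∣ q ℚ.- ℝ.seq r n ∣ ℚ.≤ ε ℚ.+ (+ 1 ℚ./ suc n)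

------------------------------------------------------------------------
-- Asymptotic density

-- The number of j ∈ X with j < m.

count : SubsetOfℕ → ℕ → ℕ
count X zero    = 0
count X (suc m) = bit (X m) + count X m

ρ : (m : ℕ) .{{_ : NonZero m}} → SubsetOfℕ → ℚ
ρ m X = + count X m ℚ./ m

-- lim_m ρ_m(X) exists and equals r.

_HasDensity_ : SubsetOfℕ → ℝ → Set
X HasDensity r = ∀ ε → 0ℚ ℚ.< ε →
  ∃ λ M → ∀ m .{{_ : NonZero m}} → M ≤ m → ∣ ρ m X - r ∣≤ ε

{-# OPTIONS --safe #-}

-- Let a be a computable approximation of A, and cut ω into intervals by a
-- computable, nondecreasing, unbounded level function that stays below f
-- and below the cube root.  On the interval of level L, B repeats the
-- initial segment of length k of a(-, L), where k starts at L and is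
-- lowered by one whenever a later stage of a disagrees with stage L below
-- k.  Only a lowering of k can change B(x), so there are at most f(x)
-- changes, and the limit value of k satisfies a(j, L) = A(j) for j < k and
-- tends to infinity with L.  Hence B consists of ever longer
-- initial segments of A, each repeated until the level changes.  The
-- segments left incomplete amount to O(L²), against L³ elements of ω, so
-- B has the density of A.

module Submission where

open import Defs
open import Data.Bool.Base using (Bool; true; false; if_then_else_; not; _∧_)
open import Data.Bool.Properties using (∧-zeroʳ)
open import Data.Fin.Base using (Fin) renaming (zero to fzero; suc to fsuc)
open import Data.Fin.Patterns using (0F; 1F; 2F; 3F)
open import Data.Integer.Base as ℤ using (+_; -[1+_]; +≤+)
import Data.Integer.Properties as ℤ
open import Data.List.Base using (length; []; _∷_)
open import Data.List.Membership.Propositional using (_∈_)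
open import Data.List.Relation.Unary.Any using (here; there)
open import Data.Nat.Base
open import Data.Nat.Properties
open import Data.Nat.Tactic.RingSolver using (solve-∀)
open import Data.Product.Base using (∃; _×_; _,_; proj₁; proj₂)
open import Data.Rational.Base as ℚ using (ℚ; mkℚ; 0ℚ; 1ℚ; toℚᵘ; *<*)
import Data.Rational.Properties as ℚ
open import Data.Rational.Solver using (module +-*-Solver)
open import Data.Rational.Unnormalised.Base as ℚᵘ using (mkℚᵘ; *≡*; *≤*)
import Data.Rational.Unnormalised.Properties as ℚᵘ
open import Data.Sum.Base using (_⊎_; inj₁; inj₂)
open import Data.Vec.Base using (Vec; []; _∷_; lookup; tabulate)
open import Data.Vec.Properties using (tabulate∘lookup)
open import Data.Vec.Relation.Binary.Pointwise.Inductive using (Pointwise; []; _∷_; tabulate⁺)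
open import Function.Base using (_∘_)
open import Function.Bundles using (Equivalence)
open import Relation.Binary.PropositionalEquality
open import Relation.Nullary using (¬_; yes; no; ofʸ; ofⁿ; contradiction)

-- Closure properties of computable functions

private
  variable
    n : ℕ
    A : Set

-- `rem`, `level` and `trusted` are all written with this recursor, so that `primRec-computable`
-- applies to them as they stand.
primRec : A → (ℕ → A → A) → ℕ → A
primRec z s zero    = z
primRec z s (suc n) = s n (primRec z s n)

-- Uncurried, so that the closure lemmas can be stated for every arity at once; `computable₁` and
-- `computable₂` lead back to `Computable`.
ComputableVec : ∀ n → (Vec ℕ n → ℕ) → Set
ComputableVec n F = ∃ λ (c : Rec n) → ∀ xs → c ⟨ xs ⟩⇓ F xs

DecidableVec : ∀ n → (Vec ℕ n → Bool) → Set
DecidableVec n P = ComputableVec n (λ xs → bit (P xs))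

private
  variable
    F G H : Vec ℕ n → ℕ
    P Q : Vec ℕ n → Bool

computable-≗ : F ≗ G → ComputableVec n F → ComputableVec n G
computable-≗ e (c , c⇓) = c , λ xs → subst (c ⟨ xs ⟩⇓_) (e xs) (c⇓ xs)

lookup-computable : (i : Fin n) → ComputableVec n (λ xs → lookup xs i)
lookup-computable i = proj i , λ _ → ⇓proj i

zero-computable : ComputableVec n (λ _ → 0)
zero-computable = Z , λ _ → ⇓Z

suc-computable : ComputableVec n F → ComputableVec n (λ xs → suc (F xs))
suc-computable (c , c⇓) = comp S (c ∷ []) , λ xs → ⇓comp (c⇓ xs ∷ []) ⇓S

compose₁ : {f : ℕ → ℕ} → Computable 1 f → ComputableVec n F →
           ComputableVec n (λ xs → f (F xs))
compose₁ (c , c⇓) (d , d⇓) = comp c (d ∷ []) , λ xs → ⇓comp (d⇓ xs ∷ []) (c⇓ _)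

compose₂ : {f : ℕ → ℕ → ℕ} → Computable 2 f →
           ComputableVec n F → ComputableVec n G →
           ComputableVec n (λ xs → f (F xs) (G xs))
compose₂ (c , c⇓) (d , d⇓) (e , e⇓) =
  comp c (d ∷ e ∷ []) , λ xs → ⇓comp (d⇓ xs ∷ e⇓ xs ∷ []) (c⇓ _)

compose₃ : {f : ℕ → ℕ → ℕ → ℕ} → Computable 3 f →
           ComputableVec n F → ComputableVec n G → ComputableVec n H →
           ComputableVec n (λ xs → f (F xs) (G xs) (H xs))
compose₃ (c , c⇓) (d , d⇓) (e , e⇓) (g , g⇓) =
  comp c (d ∷ e ∷ g ∷ []) ,
  λ xs → ⇓comp (d⇓ xs ∷ e⇓ xs ∷ g⇓ xs ∷ []) (c⇓ _)

computable₁ : ComputableVec 1 F → Computable 1 (λ x → F (x ∷ []))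
computable₁ (c , c⇓) = c , λ { (x ∷ []) → c⇓ _ }

computable₂ : ComputableVec 2 F → Computable 2 (λ x y → F (x ∷ y ∷ []))
computable₂ (c , c⇓) = c , λ { (x ∷ y ∷ []) → c⇓ _ }

primRec-computable : {St : Vec ℕ (2 + n) → ℕ} →
  ComputableVec n F → ComputableVec (2 + n) St → ComputableVec n G →
  ComputableVec n (λ xs → primRec (F xs) (λ k y → St (k ∷ y ∷ xs)) (G xs))
primRec-computable {F = F} {St = St} (c , c⇓) (d , d⇓) (e , e⇓) =
  comp (prec c d) (e ∷ tabulate proj) ,
  λ xs → ⇓comp (e⇓ xs ∷ subst (Pointwise _ (tabulate proj)) (tabulate∘lookup xs)
                                (tabulate⁺ ⇓proj))
               (rec⇓ xs _)
  where
  rec⇓ : ∀ xs k → prec c d ⟨ k ∷ xs ⟩⇓ primRec (F xs) (λ k y → St (k ∷ y ∷ xs)) k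
  rec⇓ xs zero    = ⇓prec0 (c⇓ xs)
  rec⇓ xs (suc k) = ⇓precS (rec⇓ xs k) (d⇓ _)

reindex-computable : ∀ {m n} {F : Vec ℕ m → ℕ} (σ : Fin m → Fin n) → ComputableVec m F →
                     ComputableVec n (λ xs → F (tabulate λ i → lookup xs (σ i)))
reindex-computable σ (c , c⇓) =
  comp c (tabulate λ i → proj (σ i)) , λ xs → ⇓comp (tabulate⁺ λ i → ⇓proj (σ i)) (c⇓ _)

-- Carries a parameter past the two variables, counter and previous value, that the step of a
-- primitive recursion binds.
weaken₂-computable : ComputableVec n F → ComputableVec (2 + n) (λ { (_ ∷ _ ∷ xs) → F xs })
weaken₂-computable {F = F} f =
  computable-≗ (λ { (_ ∷ _ ∷ xs) → cong F (tabulate∘lookup xs) })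
    (reindex-computable (λ i → fsuc (fsuc i)) f)

weaken-second-computable : ComputableVec (suc n) F →
                           ComputableVec (2 + n) (λ { (k ∷ _ ∷ xs) → F (k ∷ xs) })
weaken-second-computable {F = F} f =
  computable-≗ (λ { (k ∷ _ ∷ xs) → cong (λ ys → F (k ∷ ys)) (tabulate∘lookup xs) })
    (reindex-computable (λ { fzero → fzero ; (fsuc i) → fsuc (fsuc i) }) f)

-- A case distinction is a recursion of length 0 or 1.
if-computable : DecidableVec n P → ComputableVec n F → ComputableVec n G →
                ComputableVec n (λ xs → if P xs then F xs else G xs)
if-computable {P = P} {F = F} {G = G} p f g =
  computable-≗ (λ xs → primRec-bit (P xs)) (primRec-computable g (weaken₂-computable f) p)
  where
  primRec-bit : ∀ b {x y : ℕ} → primRec y (λ _ _ → x) (bit b) ≡ (if b then x else y)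
  primRec-bit true  = refl
  primRec-bit false = refl

false-decidable : DecidableVec n (λ _ → false)
false-decidable = zero-computable

true-decidable : DecidableVec n (λ _ → true)
true-decidable = suc-computable zero-computable

if-decidable : {U : Vec ℕ n → Bool} → DecidableVec n P → DecidableVec n Q → DecidableVec n U →
               DecidableVec n (λ xs → if P xs then Q xs else U xs)
if-decidable {P = P} p q u =
  computable-≗ (λ xs → if-bit (P xs)) (if-computable {P = P} p q u)
  where
  if-bit : ∀ b {x y : Bool} → (if b then bit x else bit y) ≡ bit (if b then x else y)
  if-bit true  = refl
  if-bit false = refl

∧-decidable : DecidableVec n P → DecidableVec n Q → DecidableVec n (λ xs → P xs ∧ Q xs)
∧-decidable {P = P} {Q = Q} p q =
  computable-≗ (λ xs → cong bit (lemma (P xs)))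
    (if-decidable {P = P} {Q = Q} {U = λ _ → false} p q false-decidable)
  where
  lemma : ∀ b {c} → (if b then c else false) ≡ b ∧ c
  lemma true  = refl
  lemma false = refl

not-decidable : DecidableVec n P → DecidableVec n (λ xs → not (P xs))
not-decidable {P = P} p =
  computable-≗ (λ xs → cong bit (lemma (P xs)))
    (if-decidable {P = P} {Q = λ _ → false} {U = λ _ → true} p false-decidable true-decidable)
  where
  lemma : ∀ b → (if b then false else true) ≡ not b
  lemma true  = refl
  lemma false = refl

pred-computable : ComputableVec n F → ComputableVec n (λ xs → pred (F xs))
pred-computable {F = F} f = computable-≗ (λ xs → lemma (F xs))
  (primRec-computable zero-computable (lookup-computable 0F) f)
  where
  lemma : ∀ m → primRec 0 (λ k _ → k) m ≡ pred m
  lemma zero    = refl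
  lemma (suc m) = refl

+-computable : ComputableVec n F → ComputableVec n G → ComputableVec n (λ xs → F xs + G xs)
+-computable {F = F} {G = G} f g = computable-≗ (λ xs → lemma (F xs))
  (primRec-computable g (suc-computable (lookup-computable 1F)) f)
  where
  lemma : ∀ m {n} → primRec n (λ _ → suc) m ≡ m + n
  lemma zero    = refl
  lemma (suc m) = cong suc (lemma m)

*-computable : ComputableVec n F → ComputableVec n G → ComputableVec n (λ xs → F xs * G xs)
*-computable {F = F} {G = G} f g = computable-≗ (λ xs → lemma (F xs))
  (primRec-computable zero-computable
    (+-computable (weaken₂-computable g) (lookup-computable 1F)) f)
  where
  lemma : ∀ m {n} → primRec 0 (λ _ r → n + r) m ≡ m * n
  lemma zero        = refl
  lemma (suc m) {n} = cong (λ r → n + r) (lemma m)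

∸-computable : ComputableVec n F → ComputableVec n G → ComputableVec n (λ xs → F xs ∸ G xs)
∸-computable {F = F} {G = G} f g = computable-≗ (λ xs → lemma (G xs))
  (primRec-computable f (pred-computable (lookup-computable 1F)) g)
  where
  lemma : ∀ m {n} → primRec n (λ _ → pred) m ≡ n ∸ m
  lemma zero        = refl
  lemma (suc m) {n} = trans (cong pred (lemma m)) (pred[m∸n]≡m∸[1+n] n m)

-- `m < n` holds exactly when `n ∸ m` is positive, and a recursion with constant step 1 computes the
-- sign.
<ᵇ-decidable : ComputableVec n F → ComputableVec n G → DecidableVec n (λ xs → F xs <ᵇ G xs)
<ᵇ-decidable {F = F} {G = G} f g = computable-≗ (λ xs → lemma (F xs) (G xs))
  (primRec-computable zero-computable (suc-computable zero-computable) (∸-computable g f))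
  where
  lemma : ∀ m n → primRec 0 (λ _ _ → 1) (n ∸ m) ≡ bit (m <ᵇ n)
  lemma zero    zero    = refl
  lemma zero    (suc n) = refl
  lemma (suc m) zero    = refl
  lemma (suc m) (suc n) = lemma m n

-- Bounded quantification

all< : (ℕ → Bool) → ℕ → Bool
all< P zero    = true
all< P (suc n) = P n ∧ all< P n

any< : (ℕ → Bool) → ℕ → Bool
any< P n = not (all< (λ i → not (P i)) n)

all<-decidable : {P : Vec ℕ (suc n) → Bool} → DecidableVec (suc n) P → ComputableVec n F →
                 DecidableVec n (λ xs → all< (λ i → P (i ∷ xs)) (F xs))
all<-decidable {F = F} {P = P} p f = computable-≗ (λ xs → lemma xs (F xs))
  (primRec-computable (suc-computable zero-computable)
    (if-computable {P = λ { (k ∷ _ ∷ xs) → P (k ∷ xs) }}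
      (computable-≗ (λ { (_ ∷ _ ∷ _) → refl }) (weaken-second-computable p))
      (lookup-computable 1F) zero-computable)
    f)
  where
  lemma : ∀ xs m → primRec 1 (λ k y → if P (k ∷ xs) then y else 0) m ≡
                    bit (all< (λ i → P (i ∷ xs)) m)
  lemma xs zero = refl
  lemma xs (suc m) with P (m ∷ xs)
  ... | true  = lemma xs m
  ... | false = refl

any<-decidable : {P : Vec ℕ (suc n) → Bool} → DecidableVec (suc n) P → ComputableVec n F →
                 DecidableVec n (λ xs → any< (λ i → P (i ∷ xs)) (F xs))
any<-decidable {P = P} p f =
  not-decidable (all<-decidable {P = λ xs → not (P xs)} (not-decidable {P = P} p) f)

all<-true : ∀ {P} n → (∀ i → i < n → P i ≡ true) → all< P n ≡ true
all<-true zero    h = refl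
all<-true (suc n) h = cong₂ _∧_ (h n (n<1+n n)) (all<-true n λ i i<n → h i (m<n⇒m<1+n i<n))

all<-false : ∀ {P n i} → i < n → P i ≡ false → all< P n ≡ false
all<-false {P} {suc n} {i} i<1+n e with m≤n⇒m<n∨m≡n (s≤s⁻¹ i<1+n)
... | inj₂ refl = cong (_∧ all< P n) e
... | inj₁ i<n  = trans (cong (P n ∧_) (all<-false i<n e)) (∧-zeroʳ (P n))

all<⇒∀ : ∀ {P n i} → all< P n ≡ true → i < n → P i ≡ true
all<⇒∀ {P} {n} {i} e i<n with P i in eq
... | true  = refl
... | false = trans (sym (all<-false i<n eq)) e

any<-true : ∀ {P n i} → i < n → P i ≡ true → any< P n ≡ true
any<-true i<n e = cong not (all<-false i<n (cong not e))

any<-false : ∀ {P} n → (∀ i → i < n → P i ≡ false) → any< P n ≡ false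
any<-false n h = cong not (all<-true n λ i i<n → cong not (h i i<n))

-- Properties that hold from some stage on

Eventually : (ℕ → Set) → Set
Eventually P = ∃ λ s₀ → ∀ s → s₀ ≤ s → P s

from : ∀ s₀ → Eventually (s₀ ≤_)
from s₀ = s₀ , λ _ s₀≤s → s₀≤s

eventually-map : {P Q : ℕ → Set} → (∀ s → P s → Q s) → Eventually P → Eventually Q
eventually-map h (s₀ , p) = s₀ , λ s s₀≤s → h s (p s s₀≤s)

eventually-map₂ : {P Q R : ℕ → Set} → (∀ s → P s → Q s → R s) →
                  Eventually P → Eventually Q → Eventually R
eventually-map₂ h (s₀ , p) (s₁ , q) =
  s₀ ⊔ s₁ , λ s b → h s (p s (m⊔n≤o⇒m≤o s₀ s₁ b)) (q s (m⊔n≤o⇒n≤o s₀ s₁ b))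

-- Finitely many thresholds have a maximum. As `Lim h b` unfolds to `Eventually (λ s → h s ≡ b)`,
-- this also gives a common stage for finitely many limits.
eventually-∀< : {P : ℕ → ℕ → Set} → (∀ i → Eventually (P i)) →
                ∀ n → Eventually (λ s → ∀ i → i < n → P i s)
eventually-∀< h zero = 0 , λ _ _ _ ()
eventually-∀< {P} h (suc n) = eventually-map₂ extend (h n) (eventually-∀< h n)
  where
  extend : ∀ s → P n s → (∀ i → i < n → P i s) → ∀ i → i < suc n → P i s
  extend s p ps i i<1+n with m≤n⇒m<n∨m≡n (s≤s⁻¹ i<1+n)
  ... | inj₁ i<n  = ps i i<n
  ... | inj₂ refl = p

-- Shoenfield's limit lemma

module Limit (R R′ : ℕ → ℕ → ℕ → Bool) where

  -- Stage s trusts the least surviving witness of membership (from Σ⁰₂) or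
  -- of non-membership (from Π⁰₂); a wrong one is eventually refuted.
  approx : ℕ → ℕ → Bool
  approx x s = any< (λ y → all< (R x y) s ∧ all< (λ y′ → any< (R′ x y′) s) y) s

  approx-computable : Computable 3 (λ x y z → bit (R x y z)) →
                      Computable 3 (λ x y z → bit (R′ x y z)) →
                      Computable 2 (λ x s → bit (approx x s))
  approx-computable r r′ = computable₂ {F = λ xs → bit (approx (lookup xs 0F) (lookup xs 1F))}
    -- Each quantifier puts its variable in front: the index of `x` is the number of enclosing
    -- quantifiers, and `s` comes next.
    (any<-decidable {P = λ ys → all< (R (lookup ys 1F) (lookup ys 0F)) (lookup ys 2F) ∧
                          all< (λ y′ → any< (R′ (lookup ys 1F) y′) (lookup ys 2F)) (lookup ys 0F)}
      (∧-decidable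
        {P = λ ys → all< (R (lookup ys 1F) (lookup ys 0F)) (lookup ys 2F)}
        {Q = λ ys → all< (λ y′ → any< (R′ (lookup ys 1F) y′) (lookup ys 2F)) (lookup ys 0F)}
        (all<-decidable {P = λ ys → R (lookup ys 2F) (lookup ys 1F) (lookup ys 0F)}
          (compose₃ r (lookup-computable 2F) (lookup-computable 1F) (lookup-computable 0F))
          (lookup-computable 2F))
        (all<-decidable {P = λ ys → any< (R′ (lookup ys 2F) (lookup ys 0F)) (lookup ys 3F)}
          (any<-decidable {P = λ ys → R′ (lookup ys 3F) (lookup ys 1F) (lookup ys 0F)}
            (compose₃ r′ (lookup-computable 3F) (lookup-computable 1F) (lookup-computable 0F))
            (lookup-computable 3F))
          (lookup-computable 0F)))
      (lookup-computable 1F))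

  -- Each `y′` below the witness `y₀` is refuted as a witness of non-membership by some `z`. Once
  -- `s` exceeds `y₀` and these finitely many `z`, the candidate `y₀` passes both tests.
  approx-true : ∀ {x} → (∃ λ y → ∀ z → R x y z ≡ true) →
                (∀ y → ∃ λ z → R′ x y z ≡ true) → Lim (approx x) true
  approx-true {x} (y₀ , alive) dead =
    eventually-map₂
      (λ s y₀<s d → any<-true y₀<s (cong₂ _∧_ (all<-true s λ z _ → alive z) (all<-true y₀ d)))
      (from (suc y₀))
      (eventually-∀< (λ y → let (z , e) = dead y in
        eventually-map (λ s z<s → any<-true z<s e) (from (suc z))) y₀)

  -- The witness `y₀` of non-membership is never refuted and so blocks every candidate above it; the
  -- finitely many candidates up to `y₀` are eventually refuted by `R`.
  approx-false : ∀ {x} → (∃ λ y → ∀ z → R′ x y z ≡ false) →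
                 (∀ y → ∃ λ z → R x y z ≡ false) → Lim (approx x) false
  approx-false {x} (y₀ , alive) dead =
    eventually-map (λ s d → any<-false s λ y _ → fails s d y)
      (eventually-∀< (λ y → let (z , e) = dead y in
        eventually-map (λ s z<s → all<-false z<s e) (from (suc z))) (suc y₀))
    where
    fails : ∀ s → (∀ y → y < suc y₀ → all< (R x y) s ≡ false) →
            ∀ y → all< (R x y) s ∧ all< (λ y′ → any< (R′ x y′) s) y ≡ false
    fails s d y with y ≤? y₀
    ... | yes y≤y₀ = cong (_∧ all< (λ y′ → any< (R′ x y′) s) y) (d y (s≤s y≤y₀))
    ... | no  y≰y₀ = trans
      (cong (all< (R x y) s ∧_) (all<-false (≰⇒> y≰y₀) (any<-false s λ z _ → alive z)))
      (∧-zeroʳ _)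

-- The Boolean `A x` decides which class supplies the witness and which the refutations of all rival
-- witnesses.
limit-lemma : ∀ {A} → Δ⁰₂ A → ∃ λ (a : ℕ → ℕ → Bool) →
              Computable 2 (λ x s → bit (a x s)) × (∀ x → Lim (a x) (A x))
limit-lemma {A} ((R , r , σ) , (R′ , r′ , π)) = approx , approx-computable r r′ , limit
  where
  open Limit R R′
  limit : ∀ x → Lim (approx x) (A x)
  limit x with A x in eq
  ... | true  = approx-true (Equivalence.to (proj₁ (σ x)) eq) (Equivalence.to (proj₁ (π x)) eq)
  ... | false = approx-false (Equivalence.to (proj₂ (π x)) eq) (Equivalence.to (proj₂ (σ x)) eq)

-- Cyclic remainders

rem : ℕ → ℕ → ℕ
rem k = primRec 0 (λ _ j → if suc j <ᵇ k then suc j else 0)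

rem-computable : Computable 2 rem
rem-computable = computable₂ {F = λ xs → rem (lookup xs 0F) (lookup xs 1F)}
  (primRec-computable zero-computable
    (if-computable {P = λ ys → suc (lookup ys 1F) <ᵇ lookup ys 2F}
      (<ᵇ-decidable (suc-computable (lookup-computable 1F)) (lookup-computable 2F))
      (suc-computable (lookup-computable 1F)) zero-computable)
    (lookup-computable 1F))

-- For positive `k`, `rem k m` is `m` modulo `k`. The second case closes a period: together with
-- `rem<k` it gives `k ≡ suc (rem k m)`.
rem-suc : ∀ k m → (suc (rem k m) < k × rem k (suc m) ≡ suc (rem k m)) ⊎
                  (k ≤ suc (rem k m) × rem k (suc m) ≡ 0)
rem-suc k m with suc (rem k m) <ᵇ k | <ᵇ-reflects-< (suc (rem k m)) k
... | true  | ofʸ p = inj₁ (p , refl)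
... | false | ofⁿ p = inj₂ (≮⇒≥ p , refl)

rem<k : ∀ {k} → 0 < k → ∀ m → rem k m < k
rem<k 0<k zero = 0<k
rem<k {k} 0<k (suc m) with rem-suc k m
... | inj₁ (p , e) = subst (_< k) (sym e) p
... | inj₂ (_ , e) = subst (_< k) (sym e) 0<k

-- The level function

module Level (f : ℕ → ℕ) where

  -- The first test says that the cube of `suc l` is at most `suc x`, the point from which the new
  -- level applies. Strictness in the second reserves one mind change for leaving the initial value
  -- `false`.
  raises : ℕ → ℕ → Bool
  raises x l = (suc l * (suc l * suc l) <ᵇ suc (suc x)) ∧ (suc l <ᵇ f x)

  level : ℕ → ℕ
  level = primRec 0 (λ x l → if raises x l then suc l else l)

  level-computable : Computable 1 f → Computable 1 level
  level-computable cf = computable₁ {F = λ xs → level (lookup xs 0F)}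
    (primRec-computable zero-computable
      (if-computable {P = λ ys → raises (lookup ys 0F) (lookup ys 1F)}
        (∧-decidable {P = λ ys → (suc (lookup ys 1F) * (suc (lookup ys 1F) * suc (lookup ys 1F)))
                                   <ᵇ suc (suc (lookup ys 0F))}
                     {Q = λ ys → suc (lookup ys 1F) <ᵇ f (lookup ys 0F)}
          (<ᵇ-decidable (*-computable 1+l (*-computable 1+l 1+l))
                        (suc-computable (suc-computable (lookup-computable 0F))))
          (<ᵇ-decidable 1+l (compose₁ cf (lookup-computable 0F))))
        1+l (lookup-computable 1F))
      (lookup-computable 0F))
    where
    1+l : ComputableVec 3 (λ ys → suc (lookup ys 1F))
    1+l = suc-computable (lookup-computable 1F)

  level-suc : ∀ x →
    (level (suc x) ≡ level x ×
       ¬ (suc (level x) * (suc (level x) * suc (level x)) ≤ suc x × suc (level x) < f x)) ⊎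
    (level (suc x) ≡ suc (level x) ×
       suc (level x) * (suc (level x) * suc (level x)) ≤ suc x × suc (level x) < f x)
  level-suc x
    with suc (level x) * (suc (level x) * suc (level x)) <ᵇ suc (suc x)
       | <ᵇ-reflects-< (suc (level x) * (suc (level x) * suc (level x))) (suc (suc x))
  ... | false | ofⁿ ¬p = inj₁ (refl , λ (p , _) → ¬p (s≤s p))
  ... | true  | ofʸ p
    with suc (level x) <ᵇ f x | <ᵇ-reflects-< (suc (level x)) (f x)
  ... | false | ofⁿ ¬q = inj₁ (refl , λ (_ , q) → ¬q q)
  ... | true  | ofʸ q  = inj₂ (refl , s≤s⁻¹ p , q)

  level-≤-suc : ∀ x → level x ≤ level (suc x)
  level-≤-suc x with level-suc x
  ... | inj₁ (e , _) = ≤-reflexive (sym e)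
  ... | inj₂ (e , _) = ≤-trans (n≤1+n _) (≤-reflexive (sym e))

  level-mono : ∀ {x y} → x ≤ y → level x ≤ level y
  level-mono {y = zero}  z≤n = ≤-refl
  level-mono {x} {suc y} x≤1+y with m≤n⇒m<n∨m≡n x≤1+y
  ... | inj₁ x<1+y = ≤-trans (level-mono (s≤s⁻¹ x<1+y)) (level-≤-suc y)
  ... | inj₂ refl  = ≤-refl

  level³≤ : ∀ x → level x * (level x * level x) ≤ x
  level³≤ zero = z≤n
  level³≤ (suc x) with level-suc x
  ... | inj₁ (e , _)     rewrite e = ≤-trans (level³≤ x) (n≤1+n x)
  ... | inj₂ (e , p , _) rewrite e = p

  module _ (f-mono : ∀ x y → x ≤ y → f x ≤ f y) where

    -- True when a level is entered, and preserved because `f` is nondecreasing. Level 0 is excluded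
    -- since `f` may begin with zeros.
    level<f : ∀ x → 0 < level x → level x < f x
    level<f (suc x) 0<l with level-suc x
    ... | inj₁ (e , _)     rewrite e = <-≤-trans (level<f x 0<l) (f-mono x (suc x) (n≤1+n x))
    ... | inj₂ (e , _ , q) rewrite e = <-≤-trans q (f-mono x (suc x) (n≤1+n x))

    -- At a point `y` where level `n` has been reached and both tests for `suc n` succeed, the level
    -- either exceeds `n` already or is raised.
    level-unbounded : (∀ n → ∃ λ x → n < f x) → ∀ n → Eventually (λ x → n ≤ level x)
    level-unbounded f-unbounded n =
      let (x , n≤lx) = reach n in x , λ y x≤y → ≤-trans n≤lx (level-mono x≤y)
      where
      reach : ∀ n → ∃ λ x → n ≤ level x
      reach zero = 0 , z≤n
      reach (suc n) = suc y , raised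
        where
        x₀ = proj₁ (reach n)
        x₁ = proj₁ (f-unbounded (suc n))
        n³ = suc n * (suc n * suc n)
        y = x₀ ⊔ (x₁ ⊔ n³)
        n≤ly : n ≤ level y
        n≤ly = ≤-trans (proj₂ (reach n)) (level-mono (m≤m⊔n x₀ _))
        n³≤y : n³ ≤ y
        n³≤y = ≤-trans (m≤n⊔m x₁ n³) (m≤n⊔m x₀ _)
        n<fy : suc n < f y
        n<fy = <-≤-trans (proj₂ (f-unbounded (suc n)))
                 (f-mono x₁ y (≤-trans (m≤m⊔n x₁ n³) (m≤n⊔m x₀ _)))
        raised : suc n ≤ level (suc y)
        raised with m≤n⇒m<n∨m≡n n≤ly
        ... | inj₁ n<ly = ≤-trans n<ly (level-≤-suc y)
        ... | inj₂ n≡ly with level-suc y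
        ...   | inj₂ (e , _) = ≤-reflexive (trans (cong suc n≡ly) (sym e))
        ...   | inj₁ (_ , ¬pq) = contradiction
                  (subst (λ l → suc l * (suc l * suc l) ≤ suc y × suc l < f y) n≡ly
                    (≤-trans n³≤y (n≤1+n y) , n<fy)) ¬pq

-- The f-c.e. set

all<-cong : ∀ {P Q} n → (∀ i → i < n → P i ≡ Q i) → all< P n ≡ all< Q n
all<-cong zero    h = refl
all<-cong (suc n) h = cong₂ _∧_ (h n (n<1+n n)) (all<-cong n λ i i<n → h i (m<n⇒m<1+n i<n))

-- Every drop costs at least one unit, so the number of drops plus what remains of `p` never exceeds
-- `p 0`; in this form the bound passes through the induction.
drops : (p : ℕ → ℕ) → (∀ s → p (suc s) ≤ p s) → ∀ n →
        ∃ λ l → length l + p n ≤ p 0 × (∀ s → s < n → p (suc s) < p s → s ∈ l)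
drops p p-anti zero = [] , ≤-refl , λ _ ()
drops p p-anti (suc n) with drops p p-anti n | p (suc n) <? p n
... | l , bound , complete | yes p< = n ∷ l ,
  ≤-trans (≤-reflexive (sym (+-suc (length l) (p (suc n)))))
    (≤-trans (+-monoʳ-≤ (length l) p<) bound) ,
  complete′
  where
  complete′ : ∀ s → s < suc n → p (suc s) < p s → s ∈ n ∷ l
  complete′ s s<1+n d with m≤n⇒m<n∨m≡n (s≤s⁻¹ s<1+n)
  ... | inj₁ s<n  = there (complete s s<n d)
  ... | inj₂ refl = here refl
... | l , bound , complete | no p≮ = l ,
  ≤-trans (+-monoʳ-≤ (length l) (p-anti n)) bound , complete′
  where
  complete′ : ∀ s → s < suc n → p (suc s) < p s → s ∈ l
  complete′ s s<1+n d with m≤n⇒m<n∨m≡n (s≤s⁻¹ s<1+n)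
  ... | inj₁ s<n  = complete s s<n d
  ... | inj₂ refl = contradiction d p≮

_xnor_ : Bool → Bool → Bool
b xnor c = if b then c else not c

xnor-refl : ∀ {b c} → b ≡ c → b xnor c ≡ true
xnor-refl {true}  refl = refl
xnor-refl {false} refl = refl

xnor⇒≡ : ∀ b c → b xnor c ≡ true → b ≡ c
xnor⇒≡ true  true  _ = refl
xnor⇒≡ false false _ = refl

-- Trusted initial segments of the approximation

module Trust (a : ℕ → ℕ → Bool) where

  agrees : ℕ → ℕ → ℕ → Bool
  agrees L k t = all< (λ j → a j (L + t) xnor a j L) k

  -- The length of the initial segment of a(-, L) still trusted at stage
  -- L + t.  Comparing with the fixed stage L, not with the previous stage,
  -- makes every mind change of B a decrease of this length.
  trusted : ℕ → ℕ → ℕ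
  trusted L = primRec L (λ t k → if agrees L k t then k else pred k)

  trusted-computable : Computable 2 (λ x s → bit (a x s)) → Computable 2 trusted
  trusted-computable ca = computable₂ {F = λ xs → trusted (lookup xs 0F) (lookup xs 1F)}
    (primRec-computable (lookup-computable 0F)
      (if-computable {P = λ ys → agrees (lookup ys 2F) (lookup ys 1F) (lookup ys 0F)}
        (all<-decidable
          {P = λ zs → a (lookup zs 0F) (lookup zs 3F + lookup zs 1F) xnor
                      a (lookup zs 0F) (lookup zs 3F)}
          (if-decidable
            {P = λ zs → a (lookup zs 0F) (lookup zs 3F + lookup zs 1F)}
            {Q = λ zs → a (lookup zs 0F) (lookup zs 3F)}
            {U = λ zs → not (a (lookup zs 0F) (lookup zs 3F))}
            (compose₂ ca (lookup-computable 0F)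
              (+-computable (lookup-computable 3F) (lookup-computable 1F)))
            aL (not-decidable {P = λ zs → a (lookup zs 0F) (lookup zs 3F)} aL))
          (lookup-computable 1F))
        (lookup-computable 1F) (pred-computable (lookup-computable 1F)))
      (lookup-computable 1F))
    where
    aL : DecidableVec 5 (λ zs → a (lookup zs 0F) (lookup zs 3F))
    aL = compose₂ ca (lookup-computable 0F) (lookup-computable 3F)

  trusted-suc : ∀ L t →
    (agrees L (trusted L t) t ≡ true × trusted L (suc t) ≡ trusted L t) ⊎
    (agrees L (trusted L t) t ≡ false × trusted L (suc t) ≡ pred (trusted L t))
  trusted-suc L t with agrees L (trusted L t) t
  ... | true  = inj₁ (refl , refl)
  ... | false = inj₂ (refl , refl)

  trusted-antitone : ∀ L t → trusted L (suc t) ≤ trusted L t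
  trusted-antitone L t with trusted-suc L t
  ... | inj₁ (_ , e) = ≤-reflexive e
  ... | inj₂ (_ , e) = ≤-trans (≤-reflexive e) pred[n]≤n

  trusted≤ : ∀ L t → trusted L t ≤ L
  trusted≤ L zero    = ≤-refl
  trusted≤ L (suc t) = ≤-trans (trusted-antitone L t) (trusted≤ L t)

  module _ {A : ℕ → Bool} (lim : ∀ x → Lim (a x) (A x)) where

    agreesLim : ℕ → ℕ → Bool
    agreesLim L = all< (λ j → A j xnor a j L)

    -- Past a stage `M` where `a` has reached its limit on all `j < L`, the test depends on the
    -- length alone. The length then descends to the first value that passes and stays there.
    trusted-limit : ∀ L → ∃ λ k → agreesLim L k ≡ true × Eventually (λ t → trusted L t ≡ k)
    trusted-limit L = settle (trusted L M) M ≤-refl refl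
      where
      settled = eventually-∀< lim L
      M = proj₁ settled
      agrees≡ : ∀ {k t} → k ≤ L → M ≤ t → agrees L k t ≡ agreesLim L k
      agrees≡ {k} {t} k≤L M≤t = all<-cong k λ j j<k →
        cong (_xnor a j L) (proj₂ settled (L + t) (≤-trans M≤t (m≤n+m t L)) j (<-≤-trans j<k k≤L))
      step : ∀ {k t} → M ≤ t → trusted L t ≡ k →
             trusted L (suc t) ≡ (if agreesLim L k then k else pred k)
      step {t = t} M≤t refl = cong (if_then trusted L t else pred (trusted L t))
                                   (agrees≡ (trusted≤ L t) M≤t)
      settle : ∀ k t → M ≤ t → trusted L t ≡ k →
               ∃ λ k → agreesLim L k ≡ true × Eventually (λ t → trusted L t ≡ k)
      settle k t M≤t e with agreesLim L k in eq
      ... | true = k , eq , t , λ s t≤s → subst (λ s → trusted L s ≡ k) (m∸n+n≡m t≤s) (stay (s ∸ t))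
        where
        stay : ∀ u → trusted L (u + t) ≡ k
        stay zero    = e
        stay (suc u) = trans (step (≤-trans M≤t (m≤n+m t u)) (stay u))
                             (cong (if_then k else pred k) eq)
      -- Length 0 passes vacuously, so a length that fails is a successor.
      settle (suc k) t M≤t e | false =
        settle k (suc t) (≤-trans M≤t (n≤1+n t))
          (trans (step M≤t e) (cong (if_then suc k else k) eq))

    -- If `L` is past the limit stages of all `j < K`, later stages agree with stage `L` below `K`;
    -- the test cannot fail at length `K`, so the length never falls below it.
    trusted-large : ∀ K → Eventually (λ L → ∀ t → K ≤ trusted L t)
    trusted-large K = eventually-map₂ keep (from K) (eventually-∀< lim′ K)
      where
      lim′ : ∀ j → Eventually (λ L → ∀ t → a j (L + t) ≡ a j L)
      lim′ j = let (s₀ , h) = lim j in s₀ , λ L s₀≤L t →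
        trans (h (L + t) (≤-trans s₀≤L (m≤m+n L t))) (sym (h L s₀≤L))
      keep : ∀ L → K ≤ L → (∀ j → j < K → ∀ t → a j (L + t) ≡ a j L) → ∀ t → K ≤ trusted L t
      keep L K≤L h zero = K≤L
      keep L K≤L h (suc t) with trusted-suc L t | m≤n⇒m<n∨m≡n (keep L K≤L h t)
      ... | inj₁ (_ , e) | _         = ≤-trans (keep L K≤L h t) (≤-reflexive (sym e))
      ... | inj₂ (_ , e) | inj₁ K<k  = ≤-trans (<⇒≤pred K<k) (≤-reflexive (sym e))
      ... | inj₂ (d , _) | inj₂ refl =
        contradiction (trans (sym (all<-true (trusted L t) λ j j<K → xnor-refl (h j j<K t))) d) λ ()

-- The set `B` and its mind changes

module Construction
  {f : ℕ → ℕ} {a : ℕ → ℕ → Bool} {A : SubsetOfℕ} (lev : ℕ → ℕ)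
  (lev-computable : Computable 1 lev)
  (lev<f : ∀ x → 0 < lev x → lev x < f x)
  (a-computable : Computable 2 (λ x s → bit (a x s)))
  (lim : ∀ x → Lim (a x) (A x))
  where

  open Trust a

  period : ℕ → ℕ
  period L = proj₁ (trusted-limit lim L)

  period≤ : ∀ L → period L ≤ L
  period≤ L = let (k , _ , s₀ , e) = trusted-limit lim L in
    subst (_≤ L) (e s₀ ≤-refl) (trusted≤ L s₀)

  period-large : ∀ K → Eventually (λ L → K ≤ period L)
  period-large K = eventually-map
    (λ L K≤ → let (k , _ , s₀ , e) = trusted-limit lim L in subst (K ≤_) (e s₀ ≤-refl) (K≤ s₀))
    (trusted-large lim K)

  -- The guard gives `false` when nothing is trusted. Hence the approximation never changes at level
  -- 0, where `f x` may be 0.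
  value : ℕ → ℕ → ℕ → Bool
  value k L x = (0 <ᵇ k) ∧ a (rem k x) L

  B : SubsetOfℕ
  B x = value (period (lev x)) (lev x) x

  -- The segment of limit length has passed the final test, so there stage `lev x` of `a` coincides
  -- with `A`.
  B-periodic : ∀ x → 0 < period (lev x) → B x ≡ A (rem (period (lev x)) x)
  B-periodic x 0<k = trans (positive 0<k)
    (sym (xnor⇒≡ _ _ (all<⇒∀ (proj₁ (proj₂ (trusted-limit lim (lev x)))) (rem<k 0<k x))))
    where
    positive : ∀ {k b} → 0 < k → (0 <ᵇ k) ∧ b ≡ b
    positive (s≤s _) = refl

  g : ℕ → ℕ → Bool
  g x zero    = false
  g x (suc s) = value (trusted (lev x) s) (lev x) x

  value-decidable : ∀ {n} {F G H : Vec ℕ n → ℕ} →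
    ComputableVec n F → ComputableVec n G → ComputableVec n H →
    DecidableVec n (λ xs → value (F xs) (G xs) (H xs))
  value-decidable {F = F} {G} {H} k L x =
    ∧-decidable {P = λ xs → 0 <ᵇ F xs} {Q = λ xs → a (rem (F xs) (H xs)) (G xs)}
      (<ᵇ-decidable zero-computable k)
      (compose₂ a-computable (compose₂ rem-computable k x) L)

  g-computable : Computable 2 (λ x s → bit (g x s))
  g-computable = computable₂ {F = λ xs → bit (g (lookup xs 0F) (lookup xs 1F))}
    (computable-≗ (λ xs → lemma (lookup xs 0F) (lookup xs 1F))
      (∧-decidable
        {P = λ xs → 0 <ᵇ lookup xs 1F}
        {Q = λ xs → value (trusted (lev (lookup xs 0F)) (pred (lookup xs 1F)))
                          (lev (lookup xs 0F)) (lookup xs 0F)}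
        (<ᵇ-decidable zero-computable (lookup-computable 1F))
        (value-decidable
          (compose₂ (trusted-computable a-computable) L (pred-computable (lookup-computable 1F)))
          L (lookup-computable 0F))))
    where
    L : ComputableVec 2 (λ xs → lev (lookup xs 0F))
    L = compose₁ lev-computable (lookup-computable 0F)
    lemma : ∀ x s → bit ((0 <ᵇ s) ∧ value (trusted (lev x) (pred s)) (lev x) x) ≡ bit (g x s)
    lemma x zero    = refl
    lemma x (suc s) = refl

  g-limit : ∀ x → Lim (g x) (B x)
  g-limit x = let (k , _ , s₀ , e) = trusted-limit lim (lev x) in
    suc s₀ , λ { (suc s) (s≤s s₀≤s) → cong (λ k → value k (lev x) x) (e s s₀≤s) }

  -- Starting from f x rather than lev x pays for the change from
  -- g x 0 ≡ false to g x 1.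
  potential : ℕ → ℕ → ℕ
  potential x zero    = f x
  potential x (suc s) = trusted (lev x) s

  potential-antitone : ∀ x s → potential x (suc s) ≤ potential x s
  potential-antitone x zero with 0 <? lev x
  ... | yes 0<L = <⇒≤ (lev<f x 0<L)
  ... | no  0≮L = ≤-trans (≮⇒≥ 0≮L) z≤n
  potential-antitone x (suc s) = trusted-antitone (lev x) s

  change⇒drop : ∀ x s → g x s ≢ g x (suc s) → potential x (suc s) < potential x s
  change⇒drop x zero ≢ with 0 <? lev x
  ... | yes 0<L = lev<f x 0<L
  ... | no  0≮L = contradiction
          (sym (cong (λ k → (0 <ᵇ k) ∧ a (rem (lev x) x) (lev x)) (n≤0⇒n≡0 (≮⇒≥ 0≮L)))) ≢
  change⇒drop x (suc s) ≢ = ≤∧≢⇒< (trusted-antitone (lev x) s)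
    λ e → ≢ (cong (λ k → value k (lev x) x) (sym e))

  -- All changes precede the stage `s₀` of the limit, and each lowers a potential that starts at
  -- `f x`.
  g-changes : ∀ x → ∣ (λ s → g x s ≢ g x (suc s)) ∣≤ f x
  g-changes x =
    let (s₀ , e) = g-limit x
        (l , bound , complete) = drops (potential x) (potential-antitone x) s₀
    in l , ≤-trans (m≤m+n _ _) bound , λ s ≢ → complete s
         (≰⇒> λ s₀≤s → ≢ (trans (e s s₀≤s) (sym (e (suc s) (≤-trans s₀≤s (n≤1+n s))))))
         (change⇒drop x s ≢)

  B-CE : (f -CE) B
  B-CE = record
    { g = g ; g-computable = g-computable ; g-start = λ _ → refl
    ; g-limit = g-limit ; g-changes = g-changes }

-- Counting in piecewise periodic sets

bit≤1 : ∀ b → bit b ≤ 1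
bit≤1 true  = ≤-refl
bit≤1 false = z≤n

count≤ : ∀ X m → count X m ≤ m
count≤ X zero    = z≤n
count≤ X (suc m) = +-mono-≤ (bit≤1 (X m)) (count≤ X m)

module PeriodicCount
  {lev period : ℕ → ℕ}
  (lev-mono : ∀ {x y} → x ≤ y → lev x ≤ lev y)
  (lev³≤ : ∀ x → lev x * (lev x * lev x) ≤ x)
  (lev-large : ∀ n → Eventually (λ x → n ≤ lev x))
  (period≤ : ∀ L → period L ≤ L)
  (period-large : ∀ n → Eventually (λ L → n ≤ period L))
  where

  offset : ℕ → ℕ
  offset m = rem (period (lev m)) m

  -- Kept general to cover `A` and `B` as well as their complements. The pair `d`, `v` stands for
  -- the frequency bound `v / d`, with denominators cleared.
  module _ {X Y : SubsetOfℕ} (Y-periodic : ∀ x → 0 < period (lev x) → Y x ≡ X (offset x))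
           (d v : ℕ) (bound : Eventually (λ k → d * count X k ≤ v * k)) where

    Good : ℕ → Set
    Good m = 0 < period (lev m) × (d * count X (period (lev m)) ≤ v * period (lev m))

    good : Eventually Good
    good = eventually-map (λ m h → h (lev m) ≤-refl)
      (let (L₀ , h) = eventually-map₂ (λ L 0<p b → 0<p , b) (period-large 1)
                        (let (K , b) = bound in
                         eventually-map (λ L K≤p → b (period L) K≤p) (period-large K))
       in eventually-map (λ m L₀≤ L lev≤L → h L (≤-trans L₀≤ lev≤L)) (lev-large L₀))

    m₀ : ℕ
    m₀ = proj₁ good

    -- Complete periods contribute at most v per element; the current
    -- incomplete period is accounted for by j, and each abandoned one costs
    -- at most (v + d) L′ when the level rises from L to L′, which is covered
    -- by the growth of (v + d) L².
    Invariant : ℕ → ℕ → ℕ → Set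
    Invariant m j L = d * count Y m + v * j ≤ v * m + d * count X j + (d * m₀ + (v + d) * (L * L))

    -- Inside a period both sides grow by `d * bit (X j) + v`; at its end the bound on a complete
    -- prefix of `X` is used.
    same-level : ∀ {m L} → Good m → lev m ≡ L → lev (suc m) ≡ L →
                 Invariant m (offset m) L → Invariant (suc m) (offset (suc m)) L
    same-level {m} {L} (0<k , dX≤) refl e inv rewrite e
      with rem (period L) m | rem-suc (period L) m | rem<k 0<k m | Y-periodic m 0<k
    ... | j | inj₁ (_ , e′) | _ | y rewrite e′ | y = begin
      d * (bit (X j) + count Y m) + v * suc j
        ≡⟨ lhs d v (bit (X j)) (count Y m) j ⟩
      (d * count Y m + v * j) + (d * bit (X j) + v)
        ≤⟨ +-monoˡ-≤ _ inv ⟩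
      (v * m + d * count X j + E) + (d * bit (X j) + v)
        ≡⟨ rhs d v (bit (X j)) (count X j) m E ⟩
      v * suc m + d * (bit (X j) + count X j) + E ∎
      where
      open ≤-Reasoning
      E = d * m₀ + (v + d) * (L * L)
      lhs : ∀ d v b c j → d * (b + c) + v * suc j ≡ (d * c + v * j) + (d * b + v)
      lhs = solve-∀
      rhs : ∀ d v b c m E → (v * m + d * c + E) + (d * b + v) ≡ v * suc m + d * (b + c) + E
      rhs = solve-∀
    -- Here the period equals `suc j` and the offset returns to 0. Adding `v * j` to both sides
    -- makes the old invariant applicable.
    ... | j | inj₂ (k≤ , e′) | j<k | y rewrite e′ | y = +-cancelʳ-≤ (v * j) _ _ (begin
      d * (bit (X j) + count Y m) + v * 0 + v * j
        ≡⟨ lhs d v (bit (X j)) (count Y m) j ⟩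
      (d * count Y m + v * j) + d * bit (X j)
        ≤⟨ +-monoˡ-≤ _ inv ⟩
      (v * m + d * count X j + E) + d * bit (X j)
        ≡⟨ mid d v (bit (X j)) (count X j) m E ⟩
      v * m + E + d * (bit (X j) + count X j)
        ≤⟨ +-monoʳ-≤ (v * m + E) (subst (λ k → d * count X k ≤ v * k) (≤-antisym k≤ j<k) dX≤) ⟩
      v * m + E + v * suc j
        ≡⟨ rhs d v j m E ⟩
      v * suc m + d * 0 + E + v * j ∎)
      where
      open ≤-Reasoning
      E = d * m₀ + (v + d) * (L * L)
      lhs : ∀ d v b c j → d * (b + c) + v * 0 + v * j ≡ (d * c + v * j) + d * b
      lhs = solve-∀
      mid : ∀ d v b c m E → (v * m + d * c + E) + d * b ≡ v * m + E + d * (b + c)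
      mid = solve-∀
      rhs : ∀ d v j m E → v * m + E + v * suc j ≡ v * suc m + d * 0 + E + v * j
      rhs = solve-∀

    -- Offsets are taken modulo the period from 0, not from the start of the level, so `j′` is
    -- arbitrary. The missing start of the new block costs at most `v * L′`, the abandoned block at
    -- most `d * L′`.
    new-level : ∀ {m j j′ L L′} → j < L → j′ < L′ → L < L′ →
                Invariant m j L → Invariant (suc m) j′ L′
    new-level {m} {j} {j′} {L} {L′} j<L j′<L′ L<L′ inv = begin
      d * (bit (Y m) + count Y m) + v * j′
        ≤⟨ +-mono-≤ (*-monoʳ-≤ d (+-monoˡ-≤ (count Y m) (bit≤1 (Y m)))) (*-monoʳ-≤ v (<⇒≤ j′<L′)) ⟩
      d * (1 + count Y m) + v * L′
        ≤⟨ m≤m+n _ (v * j) ⟩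
      d * (1 + count Y m) + v * L′ + v * j
        ≡⟨ e₁ d v (count Y m) j L′ ⟩
      (d * count Y m + v * j) + (d + v * L′)
        ≤⟨ +-monoˡ-≤ _ inv ⟩
      (v * m + d * count X j + (d * m₀ + (v + d) * (L * L))) + (d + v * L′)
        ≡⟨ e₂ d v (count X j) m m₀ L L′ ⟩
      v * m + (d * m₀ + (v + d) * (L * L) + d * suc (count X j) + v * L′)
        ≤⟨ +-monoʳ-≤ (v * m) (+-monoˡ-≤ (v * L′) (+-monoʳ-≤ (d * m₀ + (v + d) * (L * L))
             (*-monoʳ-≤ d (≤-trans (s≤s (count≤ X j)) (≤-trans j<L (<⇒≤ L<L′)))))) ⟩
      v * m + (d * m₀ + (v + d) * (L * L) + d * L′ + v * L′)
        ≡⟨ e₃ d v m m₀ L L′ ⟩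
      v * m + (d * m₀ + (v + d) * (L * L + L′))
        ≤⟨ +-mono-≤ (≤-trans (*-monoʳ-≤ v (n≤1+n m)) (m≤m+n _ (d * count X j′)))
             (+-monoʳ-≤ (d * m₀) (*-monoʳ-≤ (v + d) squares)) ⟩
      v * suc m + d * count X j′ + (d * m₀ + (v + d) * (L′ * L′)) ∎
      where
      open ≤-Reasoning
      e₁ : ∀ d v c j L′ → d * (1 + c) + v * L′ + v * j ≡ (d * c + v * j) + (d + v * L′)
      e₁ = solve-∀
      e₂ : ∀ d v x m m₀ L L′ →
           (v * m + d * x + (d * m₀ + (v + d) * (L * L))) + (d + v * L′) ≡
           v * m + (d * m₀ + (v + d) * (L * L) + d * suc x + v * L′)
      e₂ = solve-∀
      e₃ : ∀ d v m m₀ L L′ → v * m + (d * m₀ + (v + d) * (L * L) + d * L′ + v * L′) ≡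
           v * m + (d * m₀ + (v + d) * (L * L + L′))
      e₃ = solve-∀
      squares : L * L + L′ ≤ L′ * L′
      squares = begin
        L * L + L′   ≤⟨ +-monoˡ-≤ L′ (*-monoʳ-≤ L (<⇒≤ L<L′)) ⟩
        L * L′ + L′  ≡⟨ +-comm (L * L′) L′ ⟩
        suc L * L′   ≤⟨ *-monoˡ-≤ L′ L<L′ ⟩
        L′ * L′      ∎

    offset<lev : ∀ {m} → Good m → offset m < lev m
    offset<lev {m} (0<k , _) = <-≤-trans (rem<k 0<k m) (period≤ (lev m))

    invariant : ∀ m → m₀ ≤ m → Invariant m (offset m) (lev m)
    invariant m m₀≤m with m≤n⇒m<n∨m≡n m₀≤m
    -- Nothing is known about `Y` below `m₀`: `d * m₀` pays for all of it, and the square term for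
    -- the offset.
    invariant m m₀≤m | inj₂ refl = begin
      d * count Y m + v * offset m
        ≤⟨ +-mono-≤ (*-monoʳ-≤ d (count≤ Y m)) (*-monoʳ-≤ v (<⇒≤ j<L)) ⟩
      d * m + v * L
        ≤⟨ +-monoʳ-≤ (d * m) (*-mono-≤ (m≤m+n v d) (m≤m*n L L {{>-nonZero (≤-<-trans z≤n j<L)}})) ⟩
      d * m + (v + d) * (L * L)
        ≤⟨ m≤n+m _ (v * m + d * count X (offset m)) ⟩
      v * m + d * count X (offset m) + (d * m + (v + d) * (L * L)) ∎
      where
      open ≤-Reasoning
      L = lev m
      j<L = offset<lev (proj₂ good m ≤-refl)
    invariant (suc m) _ | inj₁ (s≤s m₀≤m) with m≤n⇒m<n∨m≡n (lev-mono (n≤1+n m))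
    ... | inj₁ L<L′ = new-level
            (offset<lev (proj₂ good m m₀≤m))
            (offset<lev (proj₂ good (suc m) (≤-trans m₀≤m (n≤1+n m)))) L<L′
            (invariant m m₀≤m)
    ... | inj₂ e = subst (Invariant (suc m) (offset (suc m))) e
            (same-level (proj₂ good m m₀≤m) refl (sym e)
              (invariant m m₀≤m))

    -- The error is at most `D` times the square of the level `L`. Once `h * D ≤ L`, its multiple by
    -- `h` is at most the cube of `L`, hence at most `m`.
    periodic-count : ∀ h → Eventually (λ m → h * (d * count Y m) ≤ h * (v * m) + m)
    periodic-count h = eventually-map₂ (λ m → final m) (from m₀) (lev-large (h * D))
      where
      open ≤-Reasoning
      -- The last `d` covers `count X (offset m)`, which is at most `L * L`; the rest is the error
      -- term of the invariant.
      D = d * m₀ + (v + d + d)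
      e₁ : ∀ h v m d m₀ Q → h * (v * m + d * Q + (d * m₀ * Q + (v + d) * Q)) ≡
                              h * (v * m) + h * (d * m₀ + (v + d + d)) * Q
      e₁ = solve-∀
      final : ∀ m → m₀ ≤ m → h * D ≤ lev m → h * (d * count Y m) ≤ h * (v * m) + m
      final m m₀≤m hD≤L = begin
        h * (d * count Y m)
          ≤⟨ *-monoʳ-≤ h (≤-trans (m≤m+n _ _) (invariant m m₀≤m)) ⟩
        h * (v * m + d * count X (offset m) + (d * m₀ + (v + d) * (L * L)))
          ≤⟨ *-monoʳ-≤ h (+-mono-≤ (+-monoʳ-≤ (v * m) (*-monoʳ-≤ d X≤))
                                    (+-monoˡ-≤ _ (m≤m*n (d * m₀) (L * L)))) ⟩
        h * (v * m + d * (L * L) + (d * m₀ * (L * L) + (v + d) * (L * L)))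
          ≡⟨ e₁ h v m d m₀ (L * L) ⟩
        h * (v * m) + h * D * (L * L)
          ≤⟨ +-monoʳ-≤ (h * (v * m)) (≤-trans (*-monoˡ-≤ (L * L) hD≤L) (lev³≤ m)) ⟩
        h * (v * m) + m ∎
        where
        L = lev m
        j<L = offset<lev (proj₂ good m m₀≤m)
        instance
          L≢0 : NonZero L
          L≢0 = >-nonZero (≤-<-trans z≤n j<L)
          L²≢0 : NonZero (L * L)
          L²≢0 = m*n≢0 L L
        X≤ : count X (offset m) ≤ L * L
        X≤ = ≤-trans (count≤ X (offset m)) (≤-trans (<⇒≤ j<L) (m≤m*n L L))

-- Passage to rational densities

eventually-suc : ∀ {P : ℕ → Set} → Eventually P → Eventually (P ∘ suc)
eventually-suc (s₀ , p) = s₀ , λ s s₀≤s → p (suc s) (m≤n⇒m≤1+n s₀≤s)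

eventually-suc⁻¹ : ∀ {P : ℕ → Set} → Eventually (P ∘ suc) → Eventually P
eventually-suc⁻¹ (s₀ , p) = suc s₀ , λ { (suc s) (s≤s s₀≤s) → p s s₀≤s }

toℚᵘ-/ : ∀ i m → toℚᵘ (i ℚ./ suc m) ℚᵘ.≃ mkℚᵘ i m
toℚᵘ-/ i m = ℚ.toℚᵘ-fromℚᵘ (mkℚᵘ i m)

p≤∣p∣ : ∀ p → p ℚ.≤ ℚ.∣ p ∣
p≤∣p∣ p with ℚ.≤-total 0ℚ p
... | inj₁ 0≤p = ℚ.≤-reflexive (sym (ℚ.0≤p⇒∣p∣≡p 0≤p))
... | inj₂ p≤0 = ℚ.≤-trans p≤0 (ℚ.0≤∣p∣ p)

∣p∣≤ : ∀ {p e} → p ℚ.≤ e → ℚ.- p ℚ.≤ e → ℚ.∣ p ∣ ℚ.≤ e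
∣p∣≤ {p} p≤ -p≤ with ℚ.∣p∣≡p∨∣p∣≡-p p
... | inj₁ e rewrite e = p≤
... | inj₂ e rewrite e = -p≤

-- A positive fraction has numerator at least 1, so its own denominator serves.
archimedean : ∀ ε → 0ℚ ℚ.< ε → ∃ λ n → + 1 ℚ./ suc n ℚ.≤ ε
archimedean ε@(mkℚ (+ suc e) h _) _ = h ,
  ℚ.toℚᵘ-cancel-≤ (ℚᵘ.≤-respˡ-≃ (ℚᵘ.≃-sym (toℚᵘ-/ (+ 1) h))
    (*≤* (ℤ.*-monoʳ-≤-nonNeg (+ suc h) (+≤+ (s≤s (z≤n {e}))))))
archimedean (mkℚ (+ zero) _ _) (*<* (ℤ.+<+ ()))
archimedean (mkℚ -[1+ _ ] _ _) (*<* ())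

ρ≤⇒count≤ : ∀ X m v d-1 → toℚᵘ (ρ (suc m) X) ℚᵘ.≤ mkℚᵘ (+ v) d-1 →
            suc d-1 * count X (suc m) ≤ v * suc m
ρ≤⇒count≤ X m v d-1 p = subst (_≤ v * suc m) (*-comm (count X (suc m)) (suc d-1))
  (ℤ.drop‿+≤+ (subst₂ ℤ._≤_ (sym (ℤ.pos-* (count X (suc m)) (suc d-1))) (sym (ℤ.pos-* v (suc m)))
    (ℚᵘ.drop-*≤* (ℚᵘ.≤-respˡ-≃ (toℚᵘ-/ (+ count X (suc m)) m) p))))

-- Division by `h * d * suc m` leaves a slack of `1 / (h * d)`, which is at most `suc e / h`.
count≤⇒ρ≤ : ∀ X m v d-1 e h-1 →
            suc h-1 * (suc d-1 * count X (suc m)) ≤ suc h-1 * (v * suc m) + suc m →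
            toℚᵘ (ρ (suc m) X) ℚᵘ.≤ mkℚᵘ (+ v) d-1 ℚᵘ.+ mkℚᵘ (+ suc e) h-1
count≤⇒ρ≤ X m v d-1 e h-1 bound =
  ℚᵘ.≤-respˡ-≃ (ℚᵘ.≃-sym (toℚᵘ-/ (+ x) m)) (*≤* (subst₂ ℤ._≤_ lhs rhs (+≤+ natural)))
  where
  open ≤-Reasoning
  x = count X (suc m)
  d = suc d-1
  h = suc h-1
  natural : x * (d * h) ≤ (v * h + suc e * d) * suc m
  natural = begin
    x * (d * h)
      ≡⟨ e₁ x d h ⟩
    h * (d * x)
      ≤⟨ bound ⟩
    h * (v * suc m) + suc m
      ≤⟨ +-monoʳ-≤ (h * (v * suc m)) (m≤n*m (suc m) (suc e * d)) ⟩
    h * (v * suc m) + (suc e * d) * suc m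
      ≡⟨ e₂ h v (suc m) (suc e * d) ⟩
    (v * h + suc e * d) * suc m ∎
    where
    e₁ : ∀ x d h → x * (d * h) ≡ h * (d * x)
    e₁ = solve-∀
    e₂ : ∀ h v m y → h * (v * m) + y * m ≡ (v * h + y) * m
    e₂ = solve-∀
  lhs : + (x * (d * h)) ≡ + x ℤ.* + (d * h)
  lhs = ℤ.pos-* x (d * h)
  rhs : + ((v * h + suc e * d) * suc m) ≡ (+ v ℤ.* + h ℤ.+ + suc e ℤ.* + d) ℤ.* + suc m
  rhs = trans (ℤ.pos-* (v * h + suc e * d) (suc m))
    (cong (ℤ._* + suc m) (trans (ℤ.pos-+ (v * h) (suc e * d))
      (cong₂ ℤ._+_ (ℤ.pos-* v h) (ℤ.pos-* (suc e) d))))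

count-complement : ∀ X m → count X m + count (not ∘ X) m ≡ m
count-complement X zero = refl
count-complement X (suc m) with X m
... | true  = cong suc (count-complement X m)
... | false = trans (+-suc _ _) (cong suc (count-complement X m))

ρ-complement : ∀ X m → ρ (suc m) X ℚ.+ ρ (suc m) (not ∘ X) ≡ 1ℚ
ρ-complement X m = ℚ.toℚᵘ-injective (begin
  toℚᵘ (ρ (suc m) X ℚ.+ ρ (suc m) (not ∘ X))
    ≈⟨ ℚ.toℚᵘ-homo-+ (ρ (suc m) X) (ρ (suc m) (not ∘ X)) ⟩
  toℚᵘ (ρ (suc m) X) ℚᵘ.+ toℚᵘ (ρ (suc m) (not ∘ X))
    ≈⟨ ℚᵘ.+-cong (toℚᵘ-/ (+ count X (suc m)) m) (toℚᵘ-/ (+ count (not ∘ X) (suc m)) m) ⟩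
  mkℚᵘ (+ count X (suc m)) m ℚᵘ.+ mkℚᵘ (+ count (not ∘ X) (suc m)) m
    ≈⟨ *≡* (trans (ℤ.*-identityʳ _)
         (trans (sym (ℤ.*-distribʳ-+ (+ suc m) (+ count X (suc m)) (+ count (not ∘ X) (suc m))))
         (trans (cong (λ i → + i ℤ.* + suc m) (count-complement X (suc m)))
         (trans (sym (ℤ.pos-* (suc m) (suc m))) (sym (ℤ.*-identityˡ _)))))) ⟩
  toℚᵘ 1ℚ ∎)
  where open import Relation.Binary.Reasoning.Setoid ℚᵘ.≃-setoid

-- Transfer of density bounds

UpperDensity≤ : SubsetOfℕ → ℚ → Set
UpperDensity≤ X q = Eventually λ m → ρ (suc m) X ℚ.≤ q

UpperDensityTransfer : SubsetOfℕ → SubsetOfℕ → Set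
UpperDensityTransfer X Y = ∀ q → UpperDensity≤ X q → ∀ η → 0ℚ ℚ.< η → UpperDensity≤ Y (q ℚ.+ η)

-- The counting hypothesis is used with `q` as `v / d` and with the denominator of `η` as `h`. A
-- negative `q` bounds no frequency.
upperDensity-transfer : ∀ {X Y} →
  (∀ d v → Eventually (λ k → d * count X k ≤ v * k) →
   ∀ h → Eventually (λ m → h * (d * count Y m) ≤ h * (v * m) + m)) →
  UpperDensityTransfer X Y
upperDensity-transfer {X} {Y} counts q@(mkℚ (+ v) d-1 _) bound η@(mkℚ (+ suc e) h-1 _) _ =
  eventually-map
    (λ m b → ℚ.toℚᵘ-cancel-≤
      (ℚᵘ.≤-respʳ-≃ (ℚᵘ.≃-sym (ℚ.toℚᵘ-homo-+ q η)) (count≤⇒ρ≤ Y m v d-1 e h-1 b)))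
    (eventually-suc (counts (suc d-1) v (eventually-suc⁻¹
      (eventually-map (λ k b → ρ≤⇒count≤ X k v d-1 (ℚ.toℚᵘ-mono-≤ b)) bound)) (suc h-1)))
upperDensity-transfer {X} _ q@(mkℚ -[1+ _ ] _ _) (K , bound) _ _ =
  contradiction
    (ℚ.≤-<-trans (ℚ.≤-trans 0≤ρ (bound K ≤-refl)) (ℚ.negative⁻¹ q))
    (ℚ.<-irrefl refl)
  where
  0≤ρ : 0ℚ ℚ.≤ ρ (suc K) X
  0≤ρ = ℚ.nonNegative⁻¹ _ {{ℚ.normalize-nonNeg (count X (suc K)) (suc K)}}
upperDensity-transfer _ _ _ (mkℚ (+ zero) _ _) (*<* (ℤ.+<+ ()))
upperDensity-transfer _ _ _ (mkℚ -[1+ _ ] _ _) (*<* ())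

-- Upper bounds suffice: by `ρ-complement`, one for the complement is a lower bound for the set.
density-transfer : ∀ {A B} r →
  UpperDensityTransfer A B → UpperDensityTransfer (not ∘ A) (not ∘ B) →
  A HasDensity r → B HasDensity r
density-transfer {A} {B} r above below densA ε 0<ε =
  let (M , h) = eventually-map₂ close upperB lowerB
  in suc M , λ { (suc m) (s≤s M≤m) → h m M≤m }
  where
  open +-*-Solver
  open ℚ.≤-Reasoning
  -- Four errors occur: the density of `A`, its limit replaced by `q`, the transfer to `B`, and the
  -- passage from `q` to `seq r n`.
  δ = ε ℚ.* (+ 1 ℚ./ 4)
  0<δ : 0ℚ ℚ.< δ
  0<δ = subst (ℚ._< δ) (ℚ.*-zeroˡ (+ 1 ℚ./ 4)) (ℚ.*-monoˡ-<-pos (+ 1 ℚ./ 4) 0<ε)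
  N = proj₁ (archimedean δ 0<δ)
  1/N≤δ = proj₂ (archimedean δ 0<δ)
  q = ℝ.seq r N
  q⁺ = q ℚ.+ (δ ℚ.+ δ)
  q⁻ = 1ℚ ℚ.- q ℚ.+ (δ ℚ.+ δ)
  3δ = δ ℚ.+ δ ℚ.+ δ

  nearA : Eventually λ m → ℚ.∣ ρ (suc m) A ℚ.- q ∣ ℚ.≤ δ ℚ.+ δ
  nearA = let (M , h) = densA δ 0<δ in
    M , λ m M≤m → ℚ.≤-trans (h (suc m) (≤-trans M≤m (n≤1+n m)) N) (ℚ.+-monoʳ-≤ δ 1/N≤δ)

  upperB : UpperDensity≤ B (q⁺ ℚ.+ δ)
  upperB = above q⁺ (eventually-map upperA nearA) δ 0<δ
    where
    upperA : ∀ m → ℚ.∣ ρ (suc m) A ℚ.- q ∣ ℚ.≤ δ ℚ.+ δ → ρ (suc m) A ℚ.≤ q⁺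
    upperA m near = begin
      x                ≡⟨ solve 2 (λ q x → x := q :+ (x :- q)) refl q x ⟩
      q ℚ.+ (x ℚ.- q)  ≤⟨ ℚ.+-monoʳ-≤ q (ℚ.≤-trans (p≤∣p∣ (x ℚ.- q)) near) ⟩
      q⁺               ∎
      where x = ρ (suc m) A

  lowerB : UpperDensity≤ (not ∘ B) (q⁻ ℚ.+ δ)
  lowerB = below q⁻ (eventually-map lowerA nearA) δ 0<δ
    where
    lowerA : ∀ m → ℚ.∣ ρ (suc m) A ℚ.- q ∣ ℚ.≤ δ ℚ.+ δ → ρ (suc m) (not ∘ A) ℚ.≤ q⁻
    lowerA m near = begin
      y
        ≡⟨ solve 3 (λ q x y → y := x :+ y :- q :+ :- (x :- q)) refl q x y ⟩
      x ℚ.+ y ℚ.- q ℚ.+ ℚ.- (x ℚ.- q)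
        ≡⟨ cong (λ u → u ℚ.- q ℚ.+ ℚ.- (x ℚ.- q)) (ρ-complement A m) ⟩
      1ℚ ℚ.- q ℚ.+ ℚ.- (x ℚ.- q)
        ≤⟨ ℚ.+-monoʳ-≤ (1ℚ ℚ.- q) (p≤∣p∣ (ℚ.- (x ℚ.- q))) ⟩
      1ℚ ℚ.- q ℚ.+ ℚ.∣ ℚ.- (x ℚ.- q) ∣
        ≡⟨ cong (ℚ._+_ (1ℚ ℚ.- q)) (ℚ.∣-p∣≡∣p∣ (x ℚ.- q)) ⟩
      1ℚ ℚ.- q ℚ.+ ℚ.∣ x ℚ.- q ∣
        ≤⟨ ℚ.+-monoʳ-≤ (1ℚ ℚ.- q) near ⟩
      q⁻ ∎
      where
      x = ρ (suc m) A
      y = ρ (suc m) (not ∘ A)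

  close : ∀ m → ρ (suc m) B ℚ.≤ q⁺ ℚ.+ δ → ρ (suc m) (not ∘ B) ℚ.≤ q⁻ ℚ.+ δ →
          ∣_-_∣≤_ (ρ (suc m) B) r ε
  close m u l n = ∣p∣≤
    (begin
      x ℚ.- s
        ≤⟨ ℚ.+-monoˡ-≤ (ℚ.- s) u ⟩
      q⁺ ℚ.+ δ ℚ.- s
        ≡⟨ solve 3 (λ q d s → q :+ (d :+ d) :+ d :- s := d :+ d :+ d :+ (q :- s)) refl q δ s ⟩
      3δ ℚ.+ (q ℚ.- s)
        ≤⟨ ℚ.+-monoʳ-≤ 3δ (ℚ.≤-trans (p≤∣p∣ (q ℚ.- s)) (ℝ.regular r N n)) ⟩
      3δ ℚ.+ (+ 1 ℚ./ suc N ℚ.+ t)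
        ≤⟨ ℚ.+-monoʳ-≤ 3δ (ℚ.+-monoˡ-≤ t 1/N≤δ) ⟩
      3δ ℚ.+ (δ ℚ.+ t)
        ≡⟨ quarters ⟩
      ε ℚ.+ t ∎)
    (begin
      ℚ.- (x ℚ.- s)
        ≡⟨ solve 3 (λ x y s → :- (x :- s) := y :+ (s :- (x :+ y))) refl x y s ⟩
      y ℚ.+ (s ℚ.- (x ℚ.+ y))
        ≡⟨ cong (λ u → y ℚ.+ (s ℚ.- u)) (ρ-complement B m) ⟩
      y ℚ.+ (s ℚ.- 1ℚ)
        ≤⟨ ℚ.+-monoˡ-≤ (s ℚ.- 1ℚ) l ⟩
      q⁻ ℚ.+ δ ℚ.+ (s ℚ.- 1ℚ)
        ≡⟨ solve 4 (λ o q d s → o :- q :+ (d :+ d) :+ d :+ (s :- o) := d :+ d :+ d :+ (s :- q))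
             refl 1ℚ q δ s ⟩
      3δ ℚ.+ (s ℚ.- q)
        ≤⟨ ℚ.+-monoʳ-≤ 3δ (ℚ.≤-trans (p≤∣p∣ (s ℚ.- q)) (ℝ.regular r n N)) ⟩
      3δ ℚ.+ (t ℚ.+ + 1 ℚ./ suc N)
        ≤⟨ ℚ.+-monoʳ-≤ 3δ (ℚ.+-monoʳ-≤ t 1/N≤δ) ⟩
      3δ ℚ.+ (t ℚ.+ δ)
        ≡⟨ cong (ℚ._+_ 3δ) (ℚ.+-comm t δ) ⟩
      3δ ℚ.+ (δ ℚ.+ t)
        ≡⟨ quarters ⟩
      ε ℚ.+ t ∎)
    where
    x = ρ (suc m) B
    y = ρ (suc m) (not ∘ B)
    s = ℝ.seq r n
    t = + 1 ℚ./ suc n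
    quarters : 3δ ℚ.+ (δ ℚ.+ t) ≡ ε ℚ.+ t
    quarters = solve 2
      (λ e t → let d = e :* con (+ 1 ℚ./ 4) in d :+ d :+ d :+ (d :+ t) := e :+ t) refl ε t

theorem5p1 : (f : ℕ → ℕ) →
    Computable 1 f →
    (∀ x y → x ≤ y → f x ≤ f y) →
    (∀ n → ∃ λ x → n < f x) →
    (A : SubsetOfℕ) → Δ⁰₂ A →
    (r : ℝ) → A HasDensity r →
    ∃ λ (B : SubsetOfℕ) → (f -CE) B × B HasDensity r
theorem5p1 f f-computable f-mono f-unbounded A A-Δ⁰₂ r A-density =
  B , B-CE , density-transfer r
    (upperDensity-transfer (periodic-count {A} B-periodic))
    -- The complement of `B` repeats segments of the complement of `A` with the same periods.
    (upperDensity-transfer (periodic-count {not ∘ A} λ x 0<k → cong not (B-periodic x 0<k)))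
    A-density
  where
  open Level f
  a-approximates = limit-lemma A-Δ⁰₂
  open Construction level (level-computable f-computable) (level<f f-mono)
    (proj₁ (proj₂ a-approximates)) (proj₂ (proj₂ a-approximates))
  open PeriodicCount level-mono level³≤ (level-unbounded f-mono f-unbounded) period≤ period-large
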